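{- For each directed graph $G=(V,E)$ there are disjoint, independent subsets $A$ and $B$ of $V$ such that $V=\mathrm{Out}_2(A)\cup\mathrm{In}_2(B)$.
   Context: Digraphs $G=(V,E)$, $E\subseteq V\times V$, may be infinite. A set $A\subseteq V$ is independent if there is no edge (in either direction) between two distinct elements of $A$. $\mathrm{Out}_2(A)$ is the set of all $v\in V$ such that there is a directed path of length at most $2$ in $G$ from some point of $A$ to $v$; $\mathrm{In}_2(B)$ is the set of all $v\in V$ such that there is a directed path of length at most $2$ in $G$ from $v$ to some point of $B$. Paths of length $0$ are allowed. -}

module Defs where

open import Data.Nat using (ℕ; zero; suc; _≤_)
open import Data.Product using (Σ; Σ-syntax; ∃-syntax; _×_)
open import Data.Sum using (_⊎_)
open import Level using (Level) renaming (suc to lsuc)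
open import Relation.Binary.Construct.Closure.ReflexiveTransitive using (Star; ε; _◅_)
open import Relation.Binary.Core using (Rel)
open import Relation.Binary.PropositionalEquality using (_≡_; _≢_)
open import Relation.Nullary using (¬_)
open import Relation.Unary using (Pred; _∈_; _≐_; Satisfiable)

-- Zermelo's axiom: every set X has a choice function on its nonempty subsets.
-- In set theory the chosen point depends only on the subset; as predicates
-- with the same elements need not be propositionally equal, and as
-- nonemptiness is a proof-relevant argument, this has to be required.
-- By Diaconescu's argument this implies excluded middle for Set ℓ.
AxiomOfChoice : (ℓ : Level) → Set (lsuc ℓ)
AxiomOfChoice ℓ = (X : Set ℓ) →
  Σ[ choose ∈ ((P : Pred X ℓ) → Satisfiable P → X) ]
    ((P : Pred X ℓ) (p : Satisfiable P) → choose P p ∈ P) ×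
    ((P Q : Pred X ℓ) (p : Satisfiable P) (q : Satisfiable Q) →
       P ≐ Q → choose P p ≡ choose Q q)

module _ {ℓ : Level} {V : Set ℓ} (E : Rel V ℓ) where

  -- Loops are allowed at the elements of an independent set.
  Independent : Pred V ℓ → Set ℓ
  Independent A = ∀ {x y} → x ∈ A → y ∈ A → x ≢ y → ¬ (E x y ⊎ E y x)

  -- Paths may repeat vertices; shortcutting such a path only shortens it, so
  -- reachability within a bounded length is unaffected.
  Path : V → V → Set ℓ
  Path = Star E

  pathLength : ∀ {x y} → Path x y → ℕ
  pathLength ε        = zero
  pathLength (_ ◅ xs) = suc (pathLength xs)

  Out₂ : Pred V ℓ → Pred V ℓ
  Out₂ A v = ∃[ a ] a ∈ A × (Σ[ p ∈ Path a v ] pathLength p ≤ 2)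

  In₂ : Pred V ℓ → Pred V ℓ
  In₂ B v = ∃[ b ] b ∈ B × (Σ[ p ∈ Path v b ] pathLength p ≤ 2)

{-# OPTIONS --safe #-}
-- Take a maximal family of non-loop edges such that distinct members share no
-- vertex and are not joined by an edge. Let A consist of the sources of these
-- edges and B of their targets together with the vertices apart from all of
-- them. By maximality no two of the latter vertices are adjacent, so A and B are
-- independent. A vertex v meeting or adjacent to a member s → t of the family
-- satisfies v = s, v = t, s → v, v → s → t, s → t → v or v → t.
module Submission where

open import Defs
open import Axiom.ExcludedMiddle using (ExcludedMiddle)
open import Data.Bool.Base using (Bool; true; false; T)
open import Data.Empty using (⊥-elim)
open import Data.Nat using (z≤n; s≤s)
open import Data.Product using (Σ-syntax; ∃-syntax; _×_; _,_; proj₁; proj₂)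
open import Data.Sum using (_⊎_; inj₁; inj₂; [_,_]′; swap)
open import Function using (_∘_; id)
open import Level using (Level; 0ℓ; Lift; lift)
open import Relation.Binary.Construct.Closure.ReflexiveTransitive using (ε; _◅_)
open import Relation.Binary.Core using (Rel)
open import Relation.Binary.Definitions using (Reflexive; Symmetric)
open import Relation.Binary.PropositionalEquality using (_≡_; _≢_; refl; sym; trans; subst)
open import Relation.Nullary using (¬_; Dec; yes; no; contradiction)
open import Relation.Nullary.Decidable using (⌊_⌋; toWitness; fromWitness; decidable-stable)
open import Relation.Unary using (Pred; Universal; Satisfiable; _∈_; _∪_; _⊥_)

private variable
  ℓ : Level

-- Excluded middle from choice.

AC⇒EM : AxiomOfChoice ℓ → ExcludedMiddle ℓ
AC⇒EM {ℓ} ac {P} = decide (choose-∈ U satU) (choose-∈ W satW)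
  where
  X : Set ℓ
  X = Lift ℓ Bool

  choose   = proj₁ (ac X)
  choose-∈ = proj₁ (proj₂ (ac X))
  choose-≐ = proj₂ (proj₂ (ac X))

  U W : Pred X ℓ
  U b = b ≡ lift true ⊎ P
  W b = b ≡ lift false ⊎ P

  satU : Satisfiable U
  satU = lift true , inj₁ refl

  satW : Satisfiable W
  satW = lift false , inj₁ refl

  decide : choose U satU ∈ U → choose W satW ∈ W → Dec P
  decide (inj₂ p) _        = yes p
  decide (inj₁ _) (inj₂ p) = yes p
  -- If `P` held, `U` and `W` would have the same elements, so the two choices would coincide,
  -- although one is `true` and the other `false`.
  decide (inj₁ u) (inj₁ w) = no λ p →
    contradiction
      (trans (sym u) (trans (choose-≐ U W satU satW ((λ _ → inj₂ p) , (λ _ → inj₂ p))) w))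
      λ ()

-- Maximal cliques of a reflexive symmetric relation.

module MaximalClique (ac : AxiomOfChoice ℓ) {Y : Set ℓ} (R : Rel Y ℓ)
  (R-refl : Reflexive R) (R-sym : Symmetric R) where

  em : ExcludedMiddle ℓ
  em = AC⇒EM ac

  choose   = proj₁ (ac Y)
  choose-∈ = proj₁ (proj₂ (ac Y))
  choose-≐ = proj₂ (proj₂ (ac Y))

  -- Boolean-valued subsets keep the powerset in Set ℓ, where excluded middle is
  -- available; this supplies the impredicativity that Zorn's lemma needs.
  Subset : Set ℓ
  Subset = Y → Bool

  _⊑_ : Subset → Subset → Set ℓ
  C ⊑ D = ∀ y → T (C y) → T (D y)

  ⊑-trans : ∀ {C D G} → C ⊑ D → D ⊑ G → C ⊑ G
  ⊑-trans p q y = q y ∘ p y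

  compr : Pred Y ℓ → Subset
  compr P y = ⌊ em {P y} ⌋

  ∈-compr⁺ : ∀ {P : Pred Y ℓ} {y} → P y → T (compr P y)
  ∈-compr⁺ = fromWitness

  ∈-compr⁻ : ∀ {P : Pred Y ℓ} {y} → T (compr P y) → P y
  ∈-compr⁻ = toWitness

  Extends : Subset → Pred Y ℓ
  Extends C y = ¬ T (C y) × (∀ x → T (C x) → R x y)

  Next : Subset → Pred Y ℓ
  Next C y = T (C y) ⊎ Σ[ s ∈ Satisfiable (Extends C) ] y ≡ choose (Extends C) s

  next : Subset → Subset
  next C = compr (Next C)

  ⊑-next : ∀ C → C ⊑ next C
  ⊑-next C y = ∈-compr⁺ {Next C} ∘ inj₁

  Extends-resp : ∀ {C D} → C ⊑ D → D ⊑ C → ∀ {y} → Extends C y → Extends D y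
  Extends-resp p q (y∉C , r) = (y∉C ∘ q _) , λ x → r x ∘ q x

  -- Subsets with the same elements need not be equal as functions; extensionality of the choice
  -- function yields the same new point for both.
  next-resp : ∀ {C D} → C ⊑ D → D ⊑ C → next C ⊑ next D
  next-resp {C} {D} p q y = ∈-compr⁺ {Next D} ∘ step ∘ ∈-compr⁻ {Next C}
    where
    step : Next C y → Next D y
    step (inj₁ y∈C)             = inj₁ (p y y∈C)
    step (inj₂ (s@(x , e) , y≡)) =
      let s′ = x , Extends-resp p q e
      in inj₂ (s′ , trans y≡ (choose-≐ (Extends C) (Extends D) s s′
                               (Extends-resp p q , Extends-resp q p)))

  Union : (Subset → Bool) → Pred Y ℓ
  Union F y = ∃[ C ] T (F C) × T (C y)

  ⋃ : (Subset → Bool) → Subset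
  ⋃ F = compr (Union F)

  ⊑-⋃ : ∀ F {C} → T (F C) → C ⊑ ⋃ F
  ⊑-⋃ F C∈F y y∈C = ∈-compr⁺ {Union F} (_ , C∈F , y∈C)

  ⋃-⊑ : ∀ F {D} → (∀ C → T (F C) → C ⊑ D) → ⋃ F ⊑ D
  ⋃-⊑ F h y y∈ with ∈-compr⁻ {Union F} y∈
  ... | C , C∈F , y∈C = h C C∈F y y∈C

  -- Zermelo's tower: the least family closed under `next` and unions, starting from the empty
  -- union. It replaces transfinite recursion.
  data Tower : Subset → Set ℓ where
    step : ∀ {C} → Tower C → Tower (next C)
    join : ∀ F → (∀ C → T (F C) → Tower C) → Tower (⋃ F)

  -- The extreme points of the Bourbaki-Witt argument; `¬ C ⊑ D` makes the inclusion proper.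
  Extreme : Subset → Set ℓ
  Extreme C = ∀ D → Tower D → D ⊑ C → ¬ C ⊑ D → next D ⊑ C

  extreme-dichotomy : ∀ {C} → Extreme C → ∀ {D} → Tower D → D ⊑ C ⊎ next C ⊑ D
  extreme-dichotomy {C} ext (step {D} t) with extreme-dichotomy ext t
  ... | inj₂ nC⊑D = inj₂ (⊑-trans nC⊑D (⊑-next D))
  ... | inj₁ D⊑C with em {C ⊑ D}
  ...   | yes C⊑D = inj₂ (next-resp C⊑D D⊑C)
  ...   | no  C⋢D = inj₁ (ext D t D⊑C C⋢D)
  -- If no member of `F` contains `next C`, induction puts them all below `C`.
  extreme-dichotomy {C} ext (join F ts) with em {∃[ D ] T (F D) × next C ⊑ D}
  ... | yes (D , D∈F , nC⊑D) = inj₂ (⊑-trans nC⊑D (⊑-⋃ F D∈F))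
  ... | no  none = inj₁ (⋃-⊑ F λ D D∈F →
    [ id , (λ nC⊑D → ⊥-elim (none (D , D∈F , nC⊑D))) ]′ (extreme-dichotomy ext (ts D D∈F)))

  tower-extreme : ∀ {C} → Tower C → Extreme C
  tower-extreme (step {C} t) D d _ ⋢D with extreme-dichotomy (tower-extreme t) d
  ... | inj₂ nC⊑D = contradiction nC⊑D ⋢D
  ... | inj₁ D⊑C with em {C ⊑ D}
  ...   | yes C⊑D = next-resp D⊑C C⊑D
  ...   | no  C⋢D = ⊑-trans (tower-extreme t D d D⊑C C⋢D) (⊑-next C)
  tower-extreme (join F ts) D d _ ⋢D with em {∃[ C ] T (F C) × D ⊑ C}
  -- If no member contains `D`, dichotomy puts them all below `D`, hence also their union.
  ... | no none = contradiction
    (⋃-⊑ F λ C C∈F →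
      [ (λ D⊑C → ⊥-elim (none (C , C∈F , D⊑C))) , ⊑-trans (⊑-next C) ]′
        (extreme-dichotomy (tower-extreme (ts C C∈F)) d))
    ⋢D
  ... | yes (C , C∈F , D⊑C) with em {C ⊑ D}
  ...   | no  C⋢D = ⊑-trans (tower-extreme (ts C C∈F) D d D⊑C C⋢D) (⊑-⋃ F C∈F)
  -- Now `C` and `D` have the same elements. The union is not below them, so comparing it with `C`
  -- shows that it contains `next C`.
  ...   | yes C⊑D with extreme-dichotomy (tower-extreme (ts C C∈F)) (join F ts)
  ...     | inj₁ ⋃⊑C  = contradiction (⊑-trans ⋃⊑C C⊑D) ⋢D
  ...     | inj₂ nC⊑⋃ = ⊑-trans (next-resp D⊑C C⊑D) nC⊑⋃

  tower-chain : ∀ {C D} → Tower C → Tower D → C ⊑ D ⊎ D ⊑ C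
  tower-chain {C} c d =
    [ inj₂ , inj₁ ∘ ⊑-trans (⊑-next C) ]′ (extreme-dichotomy (tower-extreme c) d)

  Clique : Subset → Set ℓ
  Clique C = ∀ x y → T (C x) → T (C y) → R x y

  next-clique : ∀ {C} → Clique C → Clique (next C)
  next-clique {C} clique x y x∈ y∈ =
    related (∈-compr⁻ {Next C} x∈) (∈-compr⁻ {Next C} y∈)
    where
    related : Next C x → Next C y → R x y
    related (inj₁ x∈C)        (inj₁ y∈C)        = clique x y x∈C y∈C
    related (inj₁ x∈C)        (inj₂ (s , refl)) = proj₂ (choose-∈ (Extends C) s) x x∈C
    related (inj₂ (s , refl)) (inj₁ y∈C)        = R-sym (proj₂ (choose-∈ (Extends C) s) y y∈C)
    -- Both are the newly chosen point, possibly from different witnesses of extensibility.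
    related (inj₂ (s , refl)) (inj₂ (s′ , refl)) =
      subst (R _) (choose-≐ (Extends C) (Extends C) s s′ (id , id)) R-refl

  tower-clique : ∀ {C} → Tower C → Clique C
  tower-clique (step t) = next-clique (tower-clique t)
  tower-clique (join F ts) x y x∈ y∈
    with C , C∈F , x∈C ← ∈-compr⁻ {Union F} x∈
    with D , D∈F , y∈D ← ∈-compr⁻ {Union F} y∈
    with tower-chain (ts C C∈F) (ts D D∈F)
  ... | inj₁ C⊑D = tower-clique (ts D D∈F) x y (C⊑D x x∈C) y∈D
  ... | inj₂ D⊑C = tower-clique (ts C C∈F) x y x∈C (D⊑C y y∈D)

  inTower : Subset → Bool
  inTower C = ⌊ em {Tower C} ⌋

  top : Subset
  top = ⋃ inTower

  top-tower : Tower top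
  top-tower = join inTower λ _ → toWitness

  next-top⊑top : next top ⊑ top
  next-top⊑top = ⊑-⋃ inTower (fromWitness (step top-tower))

  -- `top` is the largest tower set, so it contains `next top` and with it the chosen point, which
  -- lies outside `top`.
  top-inextensible : ¬ Satisfiable (Extends top)
  top-inextensible s = proj₁ (choose-∈ (Extends top) s)
    (next-top⊑top _ (∈-compr⁺ {Next top} (inj₂ (s , refl))))

  maximalClique : Σ[ P ∈ Pred Y 0ℓ ]
    (∀ x y → x ∈ P → y ∈ P → R x y) × (∀ y → (∀ x → x ∈ P → R x y) → y ∈ P)
  maximalClique = T ∘ top , tower-clique top-tower , λ y r →
    [ id , (λ y∉ → ⊥-elim (top-inextensible (y , y∉ , r))) ]′ (member? y)
    where
    member? : ∀ y → T (top y) ⊎ ¬ T (top y)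
    member? y with top y
    ... | true  = inj₁ _
    ... | false = inj₂ id

-- Independent sets from a maximal family of arcs.

module _ {V : Set ℓ} (E : Rel V ℓ) where

  record Arc : Set ℓ where
    constructor arc
    field
      src tgt : V
      edge    : E src tgt
      src≢tgt : src ≢ tgt
  open Arc

  Ends : Arc → Pred V ℓ
  Ends e x = x ≡ src e ⊎ x ≡ tgt e

  Apart : Rel V ℓ
  Apart x y = x ≢ y × ¬ (E x y ⊎ E y x)

  Apart-sym : Symmetric Apart
  Apart-sym (x≢y , ¬adj) = x≢y ∘ sym , ¬adj ∘ swap

  -- The equality disjunct makes the relation reflexive. Distinct arcs with common ends, differing
  -- only in their proofs, are incompatible.
  Compatible : Rel Arc ℓ
  Compatible e f = e ≡ f ⊎ (∀ {x y} → x ∈ Ends e → y ∈ Ends f → Apart x y)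

  Compatible-sym : Symmetric Compatible
  Compatible-sym (inj₁ e≡f)   = inj₁ (sym e≡f)
  Compatible-sym (inj₂ apart) = inj₂ λ y∈ x∈ → Apart-sym (apart x∈ y∈)

theorem6p1 : {ℓ : Level} → AxiomOfChoice ℓ → (V : Set ℓ) (E : Rel V ℓ) →
    Σ[ A ∈ Pred V ℓ ] Σ[ B ∈ Pred V ℓ ]
    (A ⊥ B) × Independent E A × Independent E B ×
    Universal (Out₂ E A ∪ In₂ E B)
theorem6p1 {ℓ} ac V E =
  Sources , Targets ∪ Free , disjoint , sources-independent , sinks-independent , covered
  where
  open Arc
  open MaximalClique ac (Compatible E) (inj₁ refl) (Compatible-sym E)
    using (em; maximalClique)

  P          = proj₁ maximalClique
  P-compat   = proj₁ (proj₂ maximalClique)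
  P-maximal  = proj₂ (proj₂ maximalClique)

  Sources Targets Free : Pred V ℓ
  Sources x = ∃[ e ] e ∈ P × x ≡ src e
  Targets x = ∃[ e ] e ∈ P × x ≡ tgt e
  Free x    = ∀ e → e ∈ P → ∀ {y} → y ∈ Ends E e → Apart E y x

  disjoint : Sources ⊥ (Targets ∪ Free)
  disjoint ((e , e∈P , refl) , inj₂ free) = proj₁ (free e e∈P (inj₁ refl)) refl
  disjoint ((e , e∈P , refl) , inj₁ (f , f∈P , s≡t)) with P-compat e f e∈P f∈P
  ... | inj₁ refl  = src≢tgt e s≡t
  ... | inj₂ apart = proj₁ (apart (inj₁ refl) (inj₂ refl)) s≡t

  sources-independent : Independent E Sources
  sources-independent (e , e∈P , refl) (f , f∈P , refl) x≢y with P-compat e f e∈P f∈P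
  ... | inj₁ refl  = contradiction refl x≢y
  ... | inj₂ apart = proj₂ (apart (inj₁ refl) (inj₁ refl))

  -- Such an edge would be an arc compatible with all of `P`, hence in `P` by maximality; but then
  -- the free vertex `x` would be apart from itself.
  free-no-edge : ∀ {x y} → x ∈ Free → y ∈ Free → x ≢ y → ¬ E x y
  free-no-edge {x} {y} x-free y-free x≢y xy = proj₁ (x-free e e∈P (inj₁ refl)) refl
    where
    e : Arc E
    e = arc x y xy x≢y

    e∈P : e ∈ P
    e∈P = P-maximal e λ f f∈P → inj₂ λ where
      z∈ (inj₁ refl) → x-free f f∈P z∈
      z∈ (inj₂ refl) → y-free f f∈P z∈

  sinks-independent : Independent E (Targets ∪ Free)
  sinks-independent (inj₁ (e , e∈P , refl)) (inj₁ (f , f∈P , refl)) x≢y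
    with P-compat e f e∈P f∈P
  ... | inj₁ refl  = contradiction refl x≢y
  ... | inj₂ apart = proj₂ (apart (inj₂ refl) (inj₂ refl))
  sinks-independent (inj₁ (e , e∈P , refl)) (inj₂ y-free) _ =
    proj₂ (y-free e e∈P (inj₂ refl))
  sinks-independent (inj₂ x-free) (inj₁ (f , f∈P , refl)) _ =
    proj₂ (x-free f f∈P (inj₂ refl)) ∘ swap
  sinks-independent (inj₂ x-free) (inj₂ y-free) x≢y =
    [ free-no-edge x-free y-free x≢y , free-no-edge y-free x-free (x≢y ∘ sym) ]′

  -- Any contact of `v` with an arc from `s` to `t` gives a path of length at most 2 from `s` or to
  -- `t`; paths of length 2 run along the arc itself.
  uncovered⇒free : ∀ {v} → ¬ Out₂ E Sources v → ¬ In₂ E (Targets ∪ Free) v → v ∈ Free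
  uncovered⇒free {v} ∉out ∉in e e∈P = λ where
      (inj₁ refl) → (λ { refl → ∉out (s , s∈ , ε , z≤n) }) ,
        [ (λ sv → ∉out (s , s∈ , sv ◅ ε , s≤s z≤n))
        , (λ vs → ∉in (t , t∈ , vs ◅ edge e ◅ ε , s≤s (s≤s z≤n))) ]′
      (inj₂ refl) → (λ { refl → ∉in (t , t∈ , ε , z≤n) }) ,
        [ (λ tv → ∉out (s , s∈ , edge e ◅ tv ◅ ε , s≤s (s≤s z≤n)))
        , (λ vt → ∉in (t , t∈ , vt ◅ ε , s≤s z≤n)) ]′
    where
    s = src e
    t = tgt e

    s∈ : s ∈ Sources
    s∈ = e , e∈P , refl

    t∈ : t ∈ Targets ∪ Free
    t∈ = inj₁ (e , e∈P , refl)

  covered : Universal (Out₂ E Sources ∪ In₂ E (Targets ∪ Free))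
  covered v with em {Out₂ E Sources v}
  ... | yes ∈out = inj₁ ∈out
  -- A vertex covered by neither set is free, hence itself in `Targets ∪ Free`, and the path of
  -- length 0 covers it.
  ... | no  ∉out = inj₂ (decidable-stable em λ ∉in →
    ∉in (v , inj₂ (uncovered⇒free ∉out ∉in) , ε , z≤n))
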